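{- Let $m\in\mathbb{R}^{\mathcal{P}(N)}$. Then: (i) $m\in\mathcal{K}(N)$ if and only if $T_\iota(m)\in\mathcal{K}(N)$, and the independency model induced by $T_\iota(m)$ is determined as follows: for any $\langle a,b|C\rangle\in\mathcal{E}(N)$, $$a\perp b\mid C\ [T_\iota(m)]\iff a\perp b\mid N\setminus(a\cup b\cup C)\ [m].$$ In particular, $T_\iota$ maps $\mathcal{K}(N)$ onto $\mathcal{K}(N)$. (ii) $T_\iota$ maps faces of $\mathcal{K}(N)$ to faces of $\mathcal{K}(N)$ and preserves inclusion: $G\subseteq F$ if and only if $T_\iota(G)\subseteq T_\iota(F)$ for any $G,F\subseteq\mathbb{R}^{\mathcal{P}(N)}$. In particular, $m\in\mathcal{K}(N)$ is extreme in $\mathcal{K}(N)$ if and only if $T_\iota(m)$ is extreme in $\mathcal{K}(N)$.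
   Context: $N$ is a finite set with $|N|\ge 2$ and $\mathcal{P}(N)$ is its power set; a singleton $\{a\}$ is written $a$. $\mathbb{R}^{\mathcal{P}(N)}$ is the space of functions $m:\mathcal{P}(N)\to\mathbb{R}$ with scalar product $\langle m,u\rangle=\sum_{A\subseteq N}m(A)u(A)$. A function $m$ is supermodular if $m(A)+m(B)\le m(A\cup B)+m(A\cap B)$ for all $A,B\subseteq N$; $\mathcal{K}(N)$ is the cone of supermodular functions. $\mathcal{E}(N)$ is the set of triplets $\langle a,b|C\rangle$ with $a,b\in N$ distinct and $C\subseteq N\setminus\{a,b\}$. For $m\in\mathbb{R}^{\mathcal{P}(N)}$, $a\perp b\mid C\ [m]$ means $m(a\cup b\cup C)+m(C)-m(a\cup C)-m(b\cup C)=0$. The independency model induced by $m\in\mathcal{K}(N)$ is the set of $\langle a,b|C\rangle\in\mathcal{E}(N)$ with $a\perp b\mid C\ [m]$. A face of a convex cone $K\subseteq\mathbb{R}^{\mathcal{P}(N)}$ is a set $\{m\in K: k=\langle m,v\rangle\}$, where $v\in\mathbb{R}^{\mathcal{P}(N)}$, $k\in\mathbb{R}$ satisfy $k\le\langle m,v\rangle$ for all $m\in K$. The non-empty faces of $\mathcal{K}(N)$ form a lattice under inclusion with least element the space of modular functions $\mathcal{K}(N)\cap(-\mathcal{K}(N))$. A function $m\in\mathcal{K}(N)$ is extreme in $\mathcal{K}(N)$ if the smallest face of $\mathcal{K}(N)$ containing $m$ is an atom of this lattice. The reflection transformation $T_\iota:\mathbb{R}^{\mathcal{P}(N)}\to\mathbb{R}^{\mathcal{P}(N)}$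 is $[T_\iota(m)](S)=m(N\setminus S)$ for $S\subseteq N$. -}

module Defs where

open import Data.Bool.Base using (false; true)
open import Data.Fin.Base using (Fin)
open import Data.Fin.Subset using (Subset; _∪_; _∩_; ∁; ⁅_⁆; _∉_)
open import Data.Nat.Base as ℕ using (ℕ; zero; suc)
import Data.Nat.Properties as ℕₚ
open import Data.Product.Base using (∃; ∃-syntax; _×_; _,_)
open import Data.Rational.Base as ℚ using (ℚ; 0ℚ; 1ℚ; ½; ∣_∣)
import Data.Rational.Properties as ℚₚ
open import Data.Rational.Solver using (module +-*-Solver)
open import Data.Vec.Base using ([]; _∷_)
open import Level using (Level; 0ℓ)
open import Relation.Binary.PropositionalEquality
  using (_≡_; _≢_; refl; sym; trans; cong; cong₂; subst)
open import Relation.Nullary.Negation using (¬_)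
open import Relation.Unary as Unary using (Pred; Satisfiable)

private variable
  ℓ ℓ₁ ℓ₂ : Level
  n : ℕ

------------------------------------------------------------------------
-- The real numbers, as Cauchy sequences of rationals.  They form a setoid:
-- equality of reals is _≈_, not _≡_.

IsCauchy : (ℕ → ℚ) → Set
IsCauchy s = ∀ ε → 0ℚ ℚ.< ε →
  ∃[ N ] (∀ i j → N ℕ.≤ i → N ℕ.≤ j → ∣ s i ℚ.- s j ∣ ℚ.< ε)

record ℝ : Set where
  constructor mkℝ
  field
    seq    : ℕ → ℚ
    cauchy : IsCauchy seq

open ℝ public

infix 4 _≈_ _≤_

_≈_ : ℝ → ℝ → Set
x ≈ y = ∀ ε → 0ℚ ℚ.< ε →
  ∃[ N ] (∀ i → N ℕ.≤ i → ∣ seq x i ℚ.- seq y i ∣ ℚ.< ε)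

-- x ≤ y means that, for every ε > 0, eventually seq x i < seq y i + ε.
_≤_ : ℝ → ℝ → Set
x ≤ y = ∀ ε → 0ℚ ℚ.< ε →
  ∃[ N ] (∀ i → N ℕ.≤ i → seq x i ℚ.< seq y i ℚ.+ ε)

module CauchyProofs where
  open +-*-Solver

  regroup-+ : ∀ a b c d → (a ℚ.+ b) ℚ.- (c ℚ.+ d) ≡ (a ℚ.- c) ℚ.+ (b ℚ.- d)
  regroup-+ = solve 4 (λ a b c d → (a :+ b) :- (c :+ d) := (a :- c) :+ (b :- d)) refl

  regroup-* : ∀ a b c d → a ℚ.* b ℚ.- c ℚ.* d ≡ a ℚ.* (b ℚ.- d) ℚ.+ d ℚ.* (a ℚ.- c)
  regroup-* = solve 4 (λ a b c d → a :* b :- c :* d := a :* (b :- d) :+ d :* (a :- c)) refl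

  a≡[a-b]+b : ∀ a b → a ≡ (a ℚ.- b) ℚ.+ b
  a≡[a-b]+b = solve 2 (λ a b → a := (a :- b) :+ b) refl

  0<½* : ∀ {ε} → 0ℚ ℚ.< ε → 0ℚ ℚ.< ½ ℚ.* ε
  0<½* {ε} 0<ε = ℚₚ.positive⁻¹ _ {{ℚₚ.pos*pos⇒pos ½ ε {{ℚ.positive 0<ε}}}}

  ½*+½* : ∀ ε → ½ ℚ.* ε ℚ.+ ½ ℚ.* ε ≡ ε
  ½*+½* ε = trans (sym (ℚₚ.*-distribʳ-+ ε ½ ½)) (ℚₚ.*-identityˡ ε)

  abstract
    const-cauchy : ∀ q → IsCauchy (λ _ → q)
    const-cauchy q ε 0<ε = 0 , λ _ _ _ _ →
      subst (λ r → ∣ r ∣ ℚ.< ε) (sym (ℚₚ.+-inverseʳ q)) 0<ε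

  abstract
    +-cauchy : ∀ {s t} → IsCauchy s → IsCauchy t → IsCauchy (λ i → s i ℚ.+ t i)
    +-cauchy {s} {t} cs ct ε 0<ε =
      let M , p = cs (½ ℚ.* ε) (0<½* 0<ε)
          N , q = ct (½ ℚ.* ε) (0<½* 0<ε)
      in M ℕ.⊔ N , λ i j hi hj → begin-strict
        ∣ (s i ℚ.+ t i) ℚ.- (s j ℚ.+ t j) ∣
          ≡⟨ cong ∣_∣ (regroup-+ (s i) (t i) (s j) (t j)) ⟩
        ∣ (s i ℚ.- s j) ℚ.+ (t i ℚ.- t j) ∣
          ≤⟨ ℚₚ.∣p+q∣≤∣p∣+∣q∣ (s i ℚ.- s j) (t i ℚ.- t j) ⟩
        ∣ s i ℚ.- s j ∣ ℚ.+ ∣ t i ℚ.- t j ∣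
          <⟨ ℚₚ.+-mono-< (p i j (ℕₚ.m⊔n≤o⇒m≤o M N hi) (ℕₚ.m⊔n≤o⇒m≤o M N hj))
                         (q i j (ℕₚ.m⊔n≤o⇒n≤o M N hi) (ℕₚ.m⊔n≤o⇒n≤o M N hj)) ⟩
        ½ ℚ.* ε ℚ.+ ½ ℚ.* ε
          ≡⟨ ½*+½* ε ⟩
        ε ∎
      where open ℚₚ.≤-Reasoning

  abstract
    neg-cauchy : ∀ {s} → IsCauchy s → IsCauchy (λ i → ℚ.- s i)
    neg-cauchy {s} cs ε 0<ε = let N , p = cs ε 0<ε in N , λ i j hi hj → subst (ℚ._< ε)
      (trans (sym (ℚₚ.∣-p∣≡∣p∣ (s i ℚ.- s j)))
             (cong ∣_∣ (ℚₚ.neg-distrib-+ (s i) (ℚ.- s j))))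
      (p i j hi hj)

  bounded : ∀ {s} → IsCauchy s →
    ∃[ B ] 0ℚ ℚ.< B × ∃[ N ] (∀ i → N ℕ.≤ i → ∣ s i ∣ ℚ.≤ B)
  bounded {s} cs =
    let N , p = cs 1ℚ (ℚₚ.positive⁻¹ 1ℚ) in
    1ℚ ℚ.+ ∣ s N ∣
    , ℚₚ.+-mono-<-≤ (ℚₚ.positive⁻¹ 1ℚ) (ℚₚ.0≤∣p∣ (s N))
    , N , λ i hi → begin
      ∣ s i ∣
        ≡⟨ cong ∣_∣ (a≡[a-b]+b (s i) (s N)) ⟩
      ∣ (s i ℚ.- s N) ℚ.+ s N ∣
        ≤⟨ ℚₚ.∣p+q∣≤∣p∣+∣q∣ (s i ℚ.- s N) (s N) ⟩
      ∣ s i ℚ.- s N ∣ ℚ.+ ∣ s N ∣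
        ≤⟨ ℚₚ.+-monoˡ-≤ ∣ s N ∣ (ℚₚ.<⇒≤ (p i N hi ℕₚ.≤-refl)) ⟩
      1ℚ ℚ.+ ∣ s N ∣ ∎
    where open ℚₚ.≤-Reasoning

  -- A bound B > 0 and ε > 0 yield δ > 0 with B δ = ε.
  quotient : ∀ {B ε} → 0ℚ ℚ.< B → 0ℚ ℚ.< ε → ∃[ δ ] 0ℚ ℚ.< δ × B ℚ.* δ ≡ ε
  quotient {B} {ε} 0<B 0<ε = 1/B ℚ.* ε
    , ℚₚ.positive⁻¹ _ {{ℚₚ.pos*pos⇒pos 1/B {{ℚₚ.1/pos⇒pos B}} ε {{ℚ.positive 0<ε}}}}
    , trans (sym (ℚₚ.*-assoc B 1/B ε))
        (trans (cong (ℚ._* ε) (ℚₚ.*-inverseʳ B)) (ℚₚ.*-identityˡ ε))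
    where
    instance
      B-pos : ℚ.Positive B
      B-pos = ℚ.positive 0<B
      B≢0 : ℚ.NonZero B
      B≢0 = ℚₚ.pos⇒nonZero B
    1/B : ℚ
    1/B = ℚ.1/ B

  ∣*∣< : ∀ {a b B δ} → 0ℚ ℚ.< B → ∣ a ∣ ℚ.≤ B → ∣ b ∣ ℚ.< δ → ∣ a ℚ.* b ∣ ℚ.< B ℚ.* δ
  ∣*∣< {a} {b} {B} {δ} 0<B ha hb = begin-strict
    ∣ a ℚ.* b ∣       ≡⟨ ℚₚ.∣p*q∣≡∣p∣*∣q∣ a b ⟩
    ∣ a ∣ ℚ.* ∣ b ∣   ≤⟨ ℚₚ.*-monoʳ-≤-nonNeg ∣ b ∣ {{ℚₚ.∣-∣-nonNeg b}} ha ⟩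
    B ℚ.* ∣ b ∣       <⟨ ℚₚ.*-monoʳ-<-pos B {{ℚ.positive 0<B}} hb ⟩
    B ℚ.* δ           ∎
    where open ℚₚ.≤-Reasoning

  max≤⇒K : ∀ K L M N {i} → (K ℕ.⊔ L) ℕ.⊔ (M ℕ.⊔ N) ℕ.≤ i → K ℕ.≤ i
  max≤⇒K K L M N h = ℕₚ.m⊔n≤o⇒m≤o K L (ℕₚ.m⊔n≤o⇒m≤o (K ℕ.⊔ L) (M ℕ.⊔ N) h)

  max≤⇒L : ∀ K L M N {i} → (K ℕ.⊔ L) ℕ.⊔ (M ℕ.⊔ N) ℕ.≤ i → L ℕ.≤ i
  max≤⇒L K L M N h = ℕₚ.m⊔n≤o⇒n≤o K L (ℕₚ.m⊔n≤o⇒m≤o (K ℕ.⊔ L) (M ℕ.⊔ N) h)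

  max≤⇒M : ∀ K L M N {i} → (K ℕ.⊔ L) ℕ.⊔ (M ℕ.⊔ N) ℕ.≤ i → M ℕ.≤ i
  max≤⇒M K L M N h = ℕₚ.m⊔n≤o⇒m≤o M N (ℕₚ.m⊔n≤o⇒n≤o (K ℕ.⊔ L) (M ℕ.⊔ N) h)

  max≤⇒N : ∀ K L M N {i} → (K ℕ.⊔ L) ℕ.⊔ (M ℕ.⊔ N) ℕ.≤ i → N ℕ.≤ i
  max≤⇒N K L M N h = ℕₚ.m⊔n≤o⇒n≤o M N (ℕₚ.m⊔n≤o⇒n≤o (K ℕ.⊔ L) (M ℕ.⊔ N) h)

  abstract
    *-cauchy : ∀ {s t} → IsCauchy s → IsCauchy t → IsCauchy (λ i → s i ℚ.* t i)
    *-cauchy {s} {t} cs ct ε 0<ε =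
      let A , 0<A , K , hs = bounded cs
          B , 0<B , L , ht = bounded ct
          δ , 0<δ , Aδ≡ = quotient 0<A (0<½* 0<ε)
          δ′ , 0<δ′ , Bδ′≡ = quotient 0<B (0<½* 0<ε)
          M , p = ct δ 0<δ
          N , q = cs δ′ 0<δ′
      in (K ℕ.⊔ L) ℕ.⊔ (M ℕ.⊔ N) , λ i j hi hj → begin-strict
        ∣ s i ℚ.* t i ℚ.- s j ℚ.* t j ∣
          ≡⟨ cong ∣_∣ (regroup-* (s i) (t i) (s j) (t j)) ⟩
        ∣ s i ℚ.* (t i ℚ.- t j) ℚ.+ t j ℚ.* (s i ℚ.- s j) ∣
          ≤⟨ ℚₚ.∣p+q∣≤∣p∣+∣q∣ (s i ℚ.* (t i ℚ.- t j)) (t j ℚ.* (s i ℚ.- s j)) ⟩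
        ∣ s i ℚ.* (t i ℚ.- t j) ∣ ℚ.+ ∣ t j ℚ.* (s i ℚ.- s j) ∣
          <⟨ ℚₚ.+-mono-<
               (∣*∣< {s i} {t i ℚ.- t j} 0<A (hs i (max≤⇒K K L M N hi))
                   (p i j (max≤⇒M K L M N hi) (max≤⇒M K L M N hj)))
               (∣*∣< {t j} {s i ℚ.- s j} 0<B (ht j (max≤⇒L K L M N hj))
                   (q i j (max≤⇒N K L M N hi) (max≤⇒N K L M N hj))) ⟩
        A ℚ.* δ ℚ.+ B ℚ.* δ′
          ≡⟨ cong₂ ℚ._+_ Aδ≡ Bδ′≡ ⟩
        ½ ℚ.* ε ℚ.+ ½ ℚ.* ε
          ≡⟨ ½*+½* ε ⟩
        ε ∎
      where
      open ℚₚ.≤-Reasoning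

open CauchyProofs using (const-cauchy; +-cauchy; neg-cauchy; *-cauchy)

infixl 7 _*_
infixl 6 _+_ _-_
infix  8 -_

0ℝ : ℝ
0ℝ = mkℝ (λ _ → 0ℚ) (const-cauchy 0ℚ)

_+_ : ℝ → ℝ → ℝ
x + y = mkℝ (λ i → seq x i ℚ.+ seq y i) (+-cauchy {seq x} {seq y} (cauchy x) (cauchy y))

-_ : ℝ → ℝ
- x = mkℝ (λ i → ℚ.- seq x i) (neg-cauchy {seq x} (cauchy x))

_-_ : ℝ → ℝ → ℝ
x - y = x + (- y)

_*_ : ℝ → ℝ → ℝ
x * y = mkℝ (λ i → seq x i ℚ.* seq y i) (*-cauchy {seq x} {seq y} (cauchy x) (cauchy y))

------------------------------------------------------------------------
-- Functions on the power set of N = Fin n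

ℝ^𝒫 : ℕ → Set
ℝ^𝒫 n = Subset n → ℝ

-- Equality of functions.  A subset of ℝ^𝒫(N) is a predicate respecting _≋_.
infix 4 _≋_

_≋_ : ℝ^𝒫 n → ℝ^𝒫 n → Set
m ≋ u = ∀ S → m S ≈ u S

∑⊆ : (n : ℕ) → (Subset n → ℝ) → ℝ
∑⊆ zero    f = f []
∑⊆ (suc n) f = ∑⊆ n (λ A → f (false ∷ A)) + ∑⊆ n (λ A → f (true ∷ A))

⟨_,_⟩ : ℝ^𝒫 n → ℝ^𝒫 n → ℝ
⟨_,_⟩ {n} m u = ∑⊆ n (λ A → m A * u A)

𝒦 : (n : ℕ) → Pred (ℝ^𝒫 n) 0ℓ
𝒦 n m = ∀ (A B : Subset n) → m A + m B ≤ m (A ∪ B) + m (A ∩ B)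

Modular : (n : ℕ) → Pred (ℝ^𝒫 n) 0ℓ
Modular n = 𝒦 n Unary.∩ (λ m → 𝒦 n (λ S → - m S))

record Triplet (n : ℕ) : Set where
  field
    a b : Fin n
    C   : Subset n
    a≢b : a ≢ b
    a∉C : a ∉ C
    b∉C : b ∉ C

infix 4 _⊥_∣_[_]

_⊥_∣_[_] : Fin n → Fin n → Subset n → ℝ^𝒫 n → Set
a ⊥ b ∣ C [ m ] =
  m (⁅ a ⁆ ∪ ⁅ b ⁆ ∪ C) + m C - m (⁅ a ⁆ ∪ C) - m (⁅ b ⁆ ∪ C) ≈ 0ℝ

independencyModel : ℝ^𝒫 n → Pred (Triplet n) 0ℓ
independencyModel m t = a ⊥ b ∣ C [ m ]
  where open Triplet t

------------------------------------------------------------------------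
-- Faces

IsFace : Pred (ℝ^𝒫 n) ℓ₁ → Pred (ℝ^𝒫 n) ℓ₂ → Set _
IsFace {n} K F = ∃[ v ] ∃[ k ]
  (∀ (m : ℝ^𝒫 n) → K m → k ≤ ⟨ m , v ⟩) ×
  (F Unary.≐ (λ m → K m × k ≈ ⟨ m , v ⟩))

IsSmallestFaceContaining : ℝ^𝒫 n → Pred (ℝ^𝒫 n) 0ℓ → Set₁
IsSmallestFaceContaining {n} m F =
  IsFace (𝒦 n) F × F m ×
  (∀ (G : Pred (ℝ^𝒫 n) 0ℓ) → IsFace (𝒦 n) G → G m → F Unary.⊆ G)

-- F is an atom of the lattice of non-empty faces of 𝒦 n: it covers the least
-- element.  Every face is extensionally equal to one at level 0ℓ, so the
-- restriction of G to that level loses nothing.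
IsAtom : Pred (ℝ^𝒫 n) 0ℓ → Set₁
IsAtom {n} F =
  IsFace (𝒦 n) F × Satisfiable F × Modular n Unary.⊂ F ×
  (∀ (G : Pred (ℝ^𝒫 n) 0ℓ) → IsFace (𝒦 n) G → Satisfiable G →
     ¬ (Modular n Unary.⊂ G × G Unary.⊂ F))

Extreme : Pred (ℝ^𝒫 n) _
Extreme {n} m = 𝒦 n m ×
  ∃ λ (F : Pred (ℝ^𝒫 n) 0ℓ) → IsSmallestFaceContaining m F × IsAtom F

------------------------------------------------------------------------
-- Reflection

Tι : ℝ^𝒫 n → ℝ^𝒫 n
Tι m S = m (∁ S)

-- The image of a set of functions, taken up to equality of functions.
Tι[_] : Pred (ℝ^𝒫 n) ℓ → Pred (ℝ^𝒫 n) ℓ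
Tι[ F ] u = ∃[ m ] F m × Tι m ≋ u

{-# OPTIONS --safe #-}

-- Complementation is an involution of the power set which exchanges unions and
-- intersections, so Tι is a linear involution preserving supermodularity.  Because it
-- permutes coordinates it is also self-adjoint, ⟨ Tι m , v ⟩ = ⟨ m , Tι v ⟩, and hence
-- carries the face cut out by v and k to the face cut out by Tι v and k.

module Submission where

open import Defs
import Algebra.Lattice.Properties.BooleanAlgebra as BooleanAlgebraProperties
open import Data.Bool.Base using (false; true)
open import Data.Fin.Base using (Fin)
import Data.Fin.Subset as Subset
open import Data.Fin.Subset using (Subset; _∪_; _∩_; ∁; ⁅_⁆; _∉_)
open import Data.Fin.Subset.Properties
  using (∪-comm; ∪-assoc; ∪-∩-booleanAlgebra; ⊆-antisym; q⊆p∪q; p⊆q⇒∁p⊇∁q;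
         x∈p∪q⁻; x∈p∪q⁺; x∈⁅y⁆⇒x≡y; x∈∁p⇒x∉p; x∉p⇒x∈∁p; _∈?_)
open import Data.Nat.Base as ℕ using (ℕ; zero; suc)
import Data.Nat.Properties as ℕₚ
open import Data.Product.Base using (∃-syntax; _×_; _,_)
open import Data.Rational.Base as ℚ using (ℚ; 0ℚ; ½; ∣_∣)
import Data.Rational.Properties as ℚₚ
open import Data.Rational.Solver using (module +-*-Solver)
open import Data.Sum.Base using ([_,_]; inj₁; inj₂)
open import Data.Vec.Base using ([]; _∷_)
open import Function.Base using (_∘_)
open import Function.Bundles using (_⇔_; mk⇔)
open import Level using (Level; 0ℓ)
open import Relation.Binary.Definitions using (_Respects_)
open import Relation.Binary.PropositionalEquality
  using (_≡_; _≢_; refl; sym; trans; cong; subst; subst₂)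
open import Relation.Nullary.Decidable.Core using (yes; no)
open import Relation.Unary using (Pred; _∈_; _⊆_; _≐_)

private variable
  ℓ ℓ₁ ℓ₂ : Level
  n : ℕ

open CauchyProofs using (0<½*; ½*+½*; regroup-+; a≡[a-b]+b; bounded; quotient; ∣*∣<)
open +-*-Solver

-- Null sequences of rationals

-- `x ≈ y` unfolds to `IsNull` of the difference of the two representing sequences, so laws of `_≈_`
-- reduce to closure properties of null sequences and identities in `ℚ`.
IsNull : (ℕ → ℚ) → Set
IsNull s = ∀ ε → 0ℚ ℚ.< ε → ∃[ N ] (∀ i → N ℕ.≤ i → ∣ s i ∣ ℚ.< ε)

null-resp : ∀ {s t} → (∀ i → s i ≡ t i) → IsNull s → IsNull t
null-resp s≡t null-s ε 0<ε =
  let N , p = null-s ε 0<ε in N , λ i hi → subst (λ r → ∣ r ∣ ℚ.< ε) (s≡t i) (p i hi)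

null-0 : IsNull (λ _ → 0ℚ)
null-0 ε 0<ε = 0 , λ _ _ → 0<ε

null-neg : ∀ {s} → IsNull s → IsNull (λ i → ℚ.- s i)
null-neg {s} null-s ε 0<ε =
  let N , p = null-s ε 0<ε in
  N , λ i hi → subst (ℚ._< ε) (sym (ℚₚ.∣-p∣≡∣p∣ (s i))) (p i hi)

null-+ : ∀ {s t} → IsNull s → IsNull t → IsNull (λ i → s i ℚ.+ t i)
null-+ {s} {t} null-s null-t ε 0<ε =
  let M , p = null-s (½ ℚ.* ε) (0<½* 0<ε)
      N , q = null-t (½ ℚ.* ε) (0<½* 0<ε)
  in M ℕ.⊔ N , λ i hi → begin-strict
    ∣ s i ℚ.+ t i ∣          ≤⟨ ℚₚ.∣p+q∣≤∣p∣+∣q∣ (s i) (t i) ⟩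
    ∣ s i ∣ ℚ.+ ∣ t i ∣      <⟨ ℚₚ.+-mono-< (p i (ℕₚ.m⊔n≤o⇒m≤o M N hi))
                                            (q i (ℕₚ.m⊔n≤o⇒n≤o M N hi)) ⟩
    ½ ℚ.* ε ℚ.+ ½ ℚ.* ε      ≡⟨ ½*+½* ε ⟩
    ε                        ∎
  where open ℚₚ.≤-Reasoning

-- A Cauchy sequence is eventually bounded by some `B`, so it suffices that `t` eventually stays
-- below `δ` with `B δ = ε`.
null-*ˡ : ∀ {s t} → IsCauchy s → IsNull t → IsNull (λ i → s i ℚ.* t i)
null-*ˡ {s} {t} cauchy-s null-t ε 0<ε =
  let B , 0<B , M , p = bounded cauchy-s
      δ , 0<δ , Bδ≡ε = quotient 0<B 0<ε
      N , q = null-t δ 0<δ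
  in M ℕ.⊔ N , λ i hi → subst (∣ s i ℚ.* t i ∣ ℚ.<_) Bδ≡ε
       (∣*∣< {s i} {t i} 0<B (p i (ℕₚ.m⊔n≤o⇒m≤o M N hi)) (q i (ℕₚ.m⊔n≤o⇒n≤o M N hi)))

p≤∣p∣ : ∀ p → p ℚ.≤ ∣ p ∣
p≤∣p∣ p with ℚₚ.≤-total 0ℚ p
... | inj₁ 0≤p = ℚₚ.≤-reflexive (sym (ℚₚ.0≤p⇒∣p∣≡p 0≤p))
... | inj₂ p≤0 = ℚₚ.≤-trans p≤0 (ℚₚ.0≤∣p∣ p)

-- Equality and order of reals

-- A real cannot be inferred from a proof of _≈_ or _≤_, which unfold to statements about
-- seq alone; this is why the arguments, and below many implicit ones, are given explicitly.

≡⇒≈ : ∀ x y → (∀ i → seq x i ≡ seq y i) → x ≈ y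
≡⇒≈ x y x≡y = null-resp
  (λ i → trans (sym (ℚₚ.+-inverseʳ (seq x i))) (cong (λ r → seq x i ℚ.- r) (x≡y i))) null-0

≈-refl : ∀ x → x ≈ x
≈-refl x = ≡⇒≈ x x (λ _ → refl)

≈-sym : ∀ x y → x ≈ y → y ≈ x
≈-sym x y x≈y = null-resp
  (λ i → solve 2 (λ a b → :- (a :- b) := b :- a) refl (seq x i) (seq y i)) (null-neg x≈y)

≈-trans : ∀ x y z → x ≈ y → y ≈ z → x ≈ z
≈-trans x y z x≈y y≈z = null-resp
  (λ i → solve 3 (λ a b c → (a :- b) :+ (b :- c) := a :- c) refl (seq x i) (seq y i) (seq z i))
  (null-+ x≈y y≈z)

+-cong : ∀ x x′ y y′ → x ≈ x′ → y ≈ y′ → x + y ≈ x′ + y′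
+-cong x x′ y y′ x≈x′ y≈y′ = null-resp
  (λ i → sym (regroup-+ (seq x i) (seq y i) (seq x′ i) (seq y′ i))) (null-+ x≈x′ y≈y′)

+-comm : ∀ x y → x + y ≈ y + x
+-comm x y = ≡⇒≈ (x + y) (y + x) (λ i → ℚₚ.+-comm (seq x i) (seq y i))

neg-cong : ∀ x y → x ≈ y → - x ≈ - y
neg-cong x y x≈y = null-resp
  (λ i → ℚₚ.neg-distrib-+ (seq x i) (ℚ.- seq y i)) (null-neg x≈y)

*-congʳ : ∀ x y z → x ≈ y → x * z ≈ y * z
*-congʳ x y z x≈y = null-resp
  (λ i → solve 3 (λ a b c → c :* (a :- b) := a :* c :- b :* c) refl
           (seq x i) (seq y i) (seq z i))
  (null-*ˡ {seq z} (cauchy z) x≈y)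

≤-respˡ-≈ : ∀ x x′ y → x′ ≈ x → x ≤ y → x′ ≤ y
≤-respˡ-≈ x x′ y x′≈x x≤y ε 0<ε =
  let M , p = x′≈x (½ ℚ.* ε) (0<½* 0<ε)
      N , q = x≤y (½ ℚ.* ε) (0<½* 0<ε)
  in M ℕ.⊔ N , λ i hi → begin-strict
    seq x′ i
      ≡⟨ a≡[a-b]+b (seq x′ i) (seq x i) ⟩
    (seq x′ i ℚ.- seq x i) ℚ.+ seq x i
      <⟨ ℚₚ.+-mono-< (ℚₚ.≤-<-trans (p≤∣p∣ _) (p i (ℕₚ.m⊔n≤o⇒m≤o M N hi)))
                     (q i (ℕₚ.m⊔n≤o⇒n≤o M N hi)) ⟩
    ½ ℚ.* ε ℚ.+ (seq y i ℚ.+ ½ ℚ.* ε)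
      ≡⟨ solve 2 (λ a b → a :+ (b :+ a) := b :+ (a :+ a)) refl (½ ℚ.* ε) (seq y i) ⟩
    seq y i ℚ.+ (½ ℚ.* ε ℚ.+ ½ ℚ.* ε)
      ≡⟨ cong (seq y i ℚ.+_) (½*+½* ε) ⟩
    seq y i ℚ.+ ε ∎
  where open ℚₚ.≤-Reasoning

≤-respʳ-≈ : ∀ x y y′ → y ≈ y′ → x ≤ y → x ≤ y′
≤-respʳ-≈ x y y′ y≈y′ x≤y ε 0<ε =
  let M , p = y≈y′ (½ ℚ.* ε) (0<½* 0<ε)
      N , q = x≤y (½ ℚ.* ε) (0<½* 0<ε)
  in M ℕ.⊔ N , λ i hi → begin-strict
    seq x i
      <⟨ q i (ℕₚ.m⊔n≤o⇒n≤o M N hi) ⟩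
    seq y i ℚ.+ ½ ℚ.* ε
      ≡⟨ solve 3 (λ a b c → a :+ c := (b :+ c) :+ (a :- b)) refl
           (seq y i) (seq y′ i) (½ ℚ.* ε) ⟩
    (seq y′ i ℚ.+ ½ ℚ.* ε) ℚ.+ (seq y i ℚ.- seq y′ i)
      <⟨ ℚₚ.+-monoʳ-< (seq y′ i ℚ.+ ½ ℚ.* ε)
           (ℚₚ.≤-<-trans (p≤∣p∣ _) (p i (ℕₚ.m⊔n≤o⇒m≤o M N hi))) ⟩
    (seq y′ i ℚ.+ ½ ℚ.* ε) ℚ.+ ½ ℚ.* ε
      ≡⟨ ℚₚ.+-assoc (seq y′ i) (½ ℚ.* ε) (½ ℚ.* ε) ⟩
    seq y′ i ℚ.+ (½ ℚ.* ε ℚ.+ ½ ℚ.* ε)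
      ≡⟨ cong (seq y′ i ℚ.+_) (½*+½* ε) ⟩
    seq y′ i ℚ.+ ε ∎
  where open ℚₚ.≤-Reasoning

-- Complements of subsets

module _ {n : ℕ} where
  open BooleanAlgebraProperties (∪-∩-booleanAlgebra n) public using () renaming
    ( ¬-involutive to ∁-involutive
    ; deMorgan₁    to ∁-∩
    ; deMorgan₂    to ∁-∪
    )

-- Since `x` lies in `∁ p`, enlarging `p` by `x` removes only `x` from the complement, and the union
-- puts it back.
⁅x⁆∪∁[⁅x⁆∪p]≡∁p : ∀ (x : Fin n) p → x ∉ p → ⁅ x ⁆ ∪ ∁ (⁅ x ⁆ ∪ p) ≡ ∁ p
⁅x⁆∪∁[⁅x⁆∪p]≡∁p x p x∉p = ⊆-antisym ⊆∁p ∁p⊆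
  where
  ⊆∁p : ⁅ x ⁆ ∪ ∁ (⁅ x ⁆ ∪ p) Subset.⊆ ∁ p
  ⊆∁p y∈ with x∈p∪q⁻ ⁅ x ⁆ _ y∈
  ... | inj₁ y∈⁅x⁆ = subst (Subset._∈ ∁ p) (sym (x∈⁅y⁆⇒x≡y x y∈⁅x⁆)) (x∉p⇒x∈∁p x∉p)
  ... | inj₂ y∈∁   = p⊆q⇒∁p⊇∁q (q⊆p∪q ⁅ x ⁆ p) y∈∁

  ∁p⊆ : ∁ p Subset.⊆ ⁅ x ⁆ ∪ ∁ (⁅ x ⁆ ∪ p)
  ∁p⊆ {y} y∈∁p with y ∈? ⁅ x ⁆
  ... | yes y∈⁅x⁆ = x∈p∪q⁺ (inj₁ y∈⁅x⁆)
  ... | no  y∉⁅x⁆ = x∈p∪q⁺ (inj₂ (x∉p⇒x∈∁p ([ y∉⁅x⁆ , x∈∁p⇒x∉p y∈∁p ] ∘ x∈p∪q⁻ ⁅ x ⁆ p)))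

∉-⁅⁆∪ : ∀ {x y : Fin n} {p} → x ≢ y → x ∉ p → x ∉ ⁅ y ⁆ ∪ p
∉-⁅⁆∪ {y = y} {p} x≢y x∉p = [ x≢y ∘ x∈⁅y⁆⇒x≡y y , x∉p ] ∘ x∈p∪q⁻ ⁅ y ⁆ p

module _ (t : Triplet n) where
  open Triplet t

  private
    D : Subset n
    D = ∁ (⁅ a ⁆ ∪ ⁅ b ⁆ ∪ C)

    ab-swap : ⁅ a ⁆ ∪ ⁅ b ⁆ ∪ C ≡ ⁅ b ⁆ ∪ ⁅ a ⁆ ∪ C
    ab-swap = trans (sym (∪-assoc ⁅ a ⁆ ⁅ b ⁆ C))
      (trans (cong (_∪ C) (∪-comm ⁅ a ⁆ ⁅ b ⁆)) (∪-assoc ⁅ b ⁆ ⁅ a ⁆ C))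

  -- `D` is the conditioning set of the reflected triplet. This and the next two identities show
  -- that the sets built from `D` are complements of those built from `C`, with `a` and `b`
  -- exchanged.
  a∪D≡∁[b∪C] : ⁅ a ⁆ ∪ D ≡ ∁ (⁅ b ⁆ ∪ C)
  a∪D≡∁[b∪C] = ⁅x⁆∪∁[⁅x⁆∪p]≡∁p a (⁅ b ⁆ ∪ C) (∉-⁅⁆∪ a≢b a∉C)

  b∪D≡∁[a∪C] : ⁅ b ⁆ ∪ D ≡ ∁ (⁅ a ⁆ ∪ C)
  -- Reordering the union puts `b` in front, where the one-element identity can cancel it.
  b∪D≡∁[a∪C] = trans (cong (λ S → ⁅ b ⁆ ∪ ∁ S) ab-swap)
    (⁅x⁆∪∁[⁅x⁆∪p]≡∁p b (⁅ a ⁆ ∪ C) (∉-⁅⁆∪ (a≢b ∘ sym) b∉C))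

  a∪b∪D≡∁C : ⁅ a ⁆ ∪ ⁅ b ⁆ ∪ D ≡ ∁ C
  a∪b∪D≡∁C = trans (cong (⁅ a ⁆ ∪_) b∪D≡∁[a∪C]) (⁅x⁆∪∁[⁅x⁆∪p]≡∁p a C a∉C)

-- Functions on the power set

≋-refl : (m : ℝ^𝒫 n) → m ≋ m
≋-refl m S = ≈-refl (m S)

≋-sym : (m u : ℝ^𝒫 n) → m ≋ u → u ≋ m
≋-sym m u m≋u S = ≈-sym (m S) (u S) (m≋u S)

≋-trans : (m u w : ℝ^𝒫 n) → m ≋ u → u ≋ w → m ≋ w
≋-trans m u w m≋u u≋w S = ≈-trans (m S) (u S) (w S) (m≋u S) (u≋w S)

∑⊆-cong : ∀ n (f g : ℝ^𝒫 n) → f ≋ g → ∑⊆ n f ≈ ∑⊆ n g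
∑⊆-cong zero    f g f≋g = f≋g []
∑⊆-cong (suc n) f g f≋g = +-cong
  (∑⊆ n (f ∘ (false ∷_))) (∑⊆ n (g ∘ (false ∷_)))
  (∑⊆ n (f ∘ (true ∷_))) (∑⊆ n (g ∘ (true ∷_)))
  (∑⊆-cong n (f ∘ (false ∷_)) (g ∘ (false ∷_)) (f≋g ∘ (false ∷_)))
  (∑⊆-cong n (f ∘ (true ∷_)) (g ∘ (true ∷_)) (f≋g ∘ (true ∷_)))

-- Complementation flips the first bit, so `Tι` exchanges the two halves of the recursive sum and
-- reflects each of them.
∑⊆-Tι : ∀ n (f : ℝ^𝒫 n) → ∑⊆ n (Tι f) ≈ ∑⊆ n f
∑⊆-Tι zero    f = ≈-refl (f [])
∑⊆-Tι (suc n) f = ≈-trans (∑⊆ n (Tι f₁) + ∑⊆ n (Tι f₀)) (∑⊆ n f₁ + ∑⊆ n f₀) (∑⊆ n f₀ + ∑⊆ n f₁)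
  (+-cong (∑⊆ n (Tι f₁)) (∑⊆ n f₁) (∑⊆ n (Tι f₀)) (∑⊆ n f₀) (∑⊆-Tι n f₁) (∑⊆-Tι n f₀))
  (+-comm (∑⊆ n f₁) (∑⊆ n f₀))
  where
  f₀ f₁ : ℝ^𝒫 n
  f₀ = f ∘ (false ∷_)
  f₁ = f ∘ (true ∷_)

⟨,⟩-congʳ : (m u v : ℝ^𝒫 n) → m ≋ u → ⟨ m , v ⟩ ≈ ⟨ u , v ⟩
⟨,⟩-congʳ m u v m≋u = ∑⊆-cong _ (λ A → m A * v A) (λ A → u A * v A)
  (λ A → *-congʳ (m A) (u A) (v A) (m≋u A))

-- Reflection of functions, supermodularity and independency

Tι-involutive : (m : ℝ^𝒫 n) → Tι (Tι m) ≋ m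
Tι-involutive m S = subst (λ S′ → m S′ ≈ m S) (sym (∁-involutive S)) (≈-refl (m S))

Tι-cong : (m u : ℝ^𝒫 n) → m ≋ u → Tι m ≋ Tι u
Tι-cong m u m≋u S = m≋u (∁ S)

Tι-swap : (m u : ℝ^𝒫 n) → Tι m ≋ u → Tι u ≋ m
Tι-swap m u Tιm≋u = ≋-trans (Tι u) (Tι (Tι m)) m
  (Tι-cong u (Tι m) (≋-sym (Tι m) u Tιm≋u)) (Tι-involutive m)

Tι-injective : (m u : ℝ^𝒫 n) → Tι m ≋ Tι u → m ≋ u
Tι-injective m u Tιm≋Tιu = ≋-trans m (Tι (Tι u)) u
  (≋-sym (Tι (Tι u)) m (Tι-swap m (Tι u) Tιm≋Tιu)) (Tι-involutive u)

-- Reindexing the sum by complementation reflects both factors, and the double reflection of `m`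
-- cancels.
Tι-adjoint : (m v : ℝ^𝒫 n) → ⟨ Tι m , v ⟩ ≈ ⟨ m , Tι v ⟩
Tι-adjoint {n} m v = ≈-trans ⟨ Tι m , v ⟩ (⟨ Tι (Tι m) , Tι v ⟩) ⟨ m , Tι v ⟩
  (≈-sym (⟨ Tι (Tι m) , Tι v ⟩) ⟨ Tι m , v ⟩ (∑⊆-Tι n (λ A → Tι m A * v A)))
  (⟨,⟩-congʳ (Tι (Tι m)) m (Tι v) (Tι-involutive m))

-- This is supermodularity of `m` at `∁ A` and `∁ B`: by De Morgan the two terms on the right come
-- out in the opposite order.
Tι-𝒦 : (m : ℝ^𝒫 n) → m ∈ 𝒦 n → Tι m ∈ 𝒦 n
Tι-𝒦 m m∈𝒦 A B = ≤-respʳ-≈ (m (∁ A) + m (∁ B)) (m (∁ (A ∩ B)) + m (∁ (A ∪ B)))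
  (m (∁ (A ∪ B)) + m (∁ (A ∩ B))) (+-comm (m (∁ (A ∩ B))) (m (∁ (A ∪ B))))
  (subst₂ (λ S T → m (∁ A) + m (∁ B) ≤ m S + m T)
    (sym (∁-∩ A B)) (sym (∁-∪ A B)) (m∈𝒦 (∁ A) (∁ B)))

𝒦-resp : (m u : ℝ^𝒫 n) → m ≋ u → m ∈ 𝒦 n → u ∈ 𝒦 n
𝒦-resp m u m≋u m∈𝒦 A B =
  ≤-respˡ-≈ (m A + m B) (u A + u B) (u (A ∪ B) + u (A ∩ B))
    (+-cong (u A) (m A) (u B) (m B) (u≋m A) (u≋m B))
    (≤-respʳ-≈ (m A + m B) (m (A ∪ B) + m (A ∩ B)) (u (A ∪ B) + u (A ∩ B))
      (+-cong (m (A ∪ B)) (u (A ∪ B)) (m (A ∩ B)) (u (A ∩ B)) (m≋u (A ∪ B)) (m≋u (A ∩ B)))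
      (m∈𝒦 A B))
  where
  u≋m : u ≋ m
  u≋m = ≋-sym m u m≋u

Tι-𝒦⁻ : (m : ℝ^𝒫 n) → Tι m ∈ 𝒦 n → m ∈ 𝒦 n
Tι-𝒦⁻ m Tιm∈𝒦 = 𝒦-resp (Tι (Tι m)) m (Tι-involutive m) (Tι-𝒦 (Tι m) Tιm∈𝒦)

-- Negation commutes with `Tι` by computation, so preservation of the cone applies to both `m` and
-- its negative.
Tι-Modular : (m : ℝ^𝒫 n) → m ∈ Modular n → Tι m ∈ Modular n
Tι-Modular m (m∈𝒦 , -m∈𝒦) = Tι-𝒦 m m∈𝒦 , Tι-𝒦 (λ S → - m S) -m∈𝒦

Modular-resp : (m u : ℝ^𝒫 n) → m ≋ u → m ∈ Modular n → u ∈ Modular n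
Modular-resp m u m≋u (m∈𝒦 , -m∈𝒦) = 𝒦-resp m u m≋u m∈𝒦 ,
  𝒦-resp (λ S → - m S) (λ S → - u S) (λ S → neg-cong (m S) (u S) (m≋u S)) -m∈𝒦

Tι-independency : (m : ℝ^𝒫 n) (t : Triplet n) → let open Triplet t in
  t ∈ independencyModel (Tι m) ⇔ a ⊥ b ∣ ∁ (⁅ a ⁆ ∪ ⁅ b ⁆ ∪ C) [ m ]
Tι-independency {n} m t = mk⇔ (≈-trans Y X 0ℝ (≈-sym X Y X≈Y)) (≈-trans X Y 0ℝ X≈Y)
  where
  open Triplet t

  D : Subset n
  D = ∁ (⁅ a ⁆ ∪ ⁅ b ⁆ ∪ C)

  -- `X` is the unfolded expression for `Tι m` at `C`, and `Y` the one for `m` at `D`. The three set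
  -- identities turn `Y` into `Y′`, which is `X` with its terms permuted.
  X Y Y′ : ℝ
  X = m D + m (∁ C) - m (∁ (⁅ a ⁆ ∪ C)) - m (∁ (⁅ b ⁆ ∪ C))
  Y = m (⁅ a ⁆ ∪ ⁅ b ⁆ ∪ D) + m D - m (⁅ a ⁆ ∪ D) - m (⁅ b ⁆ ∪ D)
  Y′ = m (∁ C) + m D - m (∁ (⁅ b ⁆ ∪ C)) - m (∁ (⁅ a ⁆ ∪ C))

  X≈Y : X ≈ Y
  X≈Y rewrite a∪b∪D≡∁C t | a∪D≡∁[b∪C] t | b∪D≡∁[a∪C] t = ≡⇒≈ X Y′ (λ i →
    solve 4 (λ d c a b → ((d :+ c) :- a) :- b := ((c :+ d) :- b) :- a) refl
      (seq (m D) i) (seq (m (∁ C)) i)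
      (seq (m (∁ (⁅ a ⁆ ∪ C))) i) (seq (m (∁ (⁅ b ⁆ ∪ C))) i))

-- Images under Tι

Tι[]-mono : (G : Pred (ℝ^𝒫 n) ℓ₁) (F : Pred (ℝ^𝒫 n) ℓ₂) → G ⊆ F → Tι[ G ] ⊆ Tι[ F ]
Tι[]-mono G F G⊆F (m , m∈G , Tιm≋u) = m , G⊆F m∈G , Tιm≋u

∈⇒Tι∈Tι[] : (F : Pred (ℝ^𝒫 n) ℓ) (m : ℝ^𝒫 n) → m ∈ F → Tι m ∈ Tι[ F ]
∈⇒Tι∈Tι[] F m m∈F = m , m∈F , ≋-refl (Tι m)

-- The preimage found in `F` agrees with the given element of `G` only up to `_≋_`; closure of `F`
-- under `_≋_` bridges the gap.
Tι[]-mono⁻ : (G : Pred (ℝ^𝒫 n) ℓ₁) (F : Pred (ℝ^𝒫 n) ℓ₂) →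
  F Respects _≋_ → Tι[ G ] ⊆ Tι[ F ] → G ⊆ F
Tι[]-mono⁻ G F F-resp TιG⊆TιF {g} g∈G =
  let f , f∈F , Tιf≋Tιg = TιG⊆TιF {Tι g} (∈⇒Tι∈Tι[] G g g∈G) in F-resp (Tι-injective f g Tιf≋Tιg) f∈F

Tι[]-⊆ : (G : Pred (ℝ^𝒫 n) ℓ₁) (F : Pred (ℝ^𝒫 n) ℓ₂) →
  F Respects _≋_ → G ⊆ F ⇔ Tι[ G ] ⊆ Tι[ F ]
Tι[]-⊆ G F F-resp = mk⇔ {A = G ⊆ F} {B = Tι[ G ] ⊆ Tι[ F ]}
  (λ G⊆F {u} → Tι[]-mono G F G⊆F {u})
  (λ TιG⊆TιF → Tι[]-mono⁻ G F F-resp (λ {u} → TιG⊆TιF {u}))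

-- As `Tι` is its own inverse, it can be moved from one side of an inclusion to the other; the next
-- lemma moves it back.
Tι[]⊆⇒⊆Tι[] : (G : Pred (ℝ^𝒫 n) ℓ₁) (F : Pred (ℝ^𝒫 n) ℓ₂) → Tι[ G ] ⊆ F → G ⊆ Tι[ F ]
Tι[]⊆⇒⊆Tι[] G F TιG⊆F {g} g∈G = Tι g , TιG⊆F {Tι g} (∈⇒Tι∈Tι[] G g g∈G) , Tι-involutive g

⊆Tι[]⇒Tι[]⊆ : (G : Pred (ℝ^𝒫 n) ℓ₁) (F : Pred (ℝ^𝒫 n) ℓ₂) →
  F Respects _≋_ → G ⊆ Tι[ F ] → Tι[ G ] ⊆ F
⊆Tι[]⇒Tι[]⊆ G F F-resp G⊆TιF {u} (g , g∈G , Tιg≋u) =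
  let f , f∈F , Tιf≋g = G⊆TιF g∈G in
  F-resp (≋-trans f (Tι g) u (≋-sym (Tι g) f (Tι-swap f g Tιf≋g)) Tιg≋u) f∈F

Tι[𝒦]≐𝒦 : Tι[ 𝒦 n ] ≐ 𝒦 n
Tι[𝒦]≐𝒦 =
  (λ {u} (m , m∈𝒦 , Tιm≋u) → 𝒦-resp (Tι m) u Tιm≋u (Tι-𝒦 m m∈𝒦)) ,
  (λ {m} m∈𝒦 → Tι m , Tι-𝒦 m m∈𝒦 , Tι-involutive m)

-- Moving `Tι` across this inclusion gives the reverse one, so reflection fixes the least face; the
-- proof for atoms relies on this.
Tι[Modular]⊆Modular : ∀ {n} → Tι[ Modular n ] ⊆ Modular n
Tι[Modular]⊆Modular {x = u} (m , m∈M , Tιm≋u) =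
  Modular-resp (Tι m) u Tιm≋u (Tι-Modular m m∈M)

-- Faces and extreme functions

-- Both the cone and the pairing with `v` respect `_≋_`. This supplies the closure hypothesis
-- whenever `Tι` is moved across an inclusion of faces.
face-resp : (F : Pred (ℝ^𝒫 n) ℓ) → IsFace (𝒦 n) F → F Respects _≋_
face-resp F (v , k , _ , F⊆ , ⊆F) {m} {u} m≋u m∈F =
  let m∈𝒦 , k≈ = F⊆ m∈F in
  ⊆F (𝒦-resp m u m≋u m∈𝒦 , ≈-trans k ⟨ m , v ⟩ ⟨ u , v ⟩ k≈ (⟨,⟩-congʳ m u v m≋u))

Tι[]-face : (F : Pred (ℝ^𝒫 n) ℓ) → IsFace (𝒦 n) F → IsFace (𝒦 n) Tι[ F ]
Tι[]-face {n} F face@(v , k , k≤ , F⊆ , ⊆F) = Tι v , k , k≤Tι , TιF⊆ , ⊆TιF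
  where
  k≤Tι : ∀ m → m ∈ 𝒦 n → k ≤ ⟨ m , Tι v ⟩
  k≤Tι m m∈𝒦 = ≤-respʳ-≈ k ⟨ Tι m , v ⟩ ⟨ m , Tι v ⟩ (Tι-adjoint m v) (k≤ (Tι m) (Tι-𝒦 m m∈𝒦))

  ⊆TιF : ∀ {u} → u ∈ 𝒦 n × k ≈ ⟨ u , Tι v ⟩ → u ∈ Tι[ F ]
  ⊆TιF {u} (u∈𝒦 , k≈) = Tι u
    , ⊆F (Tι-𝒦 u u∈𝒦 , ≈-trans k ⟨ u , Tι v ⟩ ⟨ Tι u , v ⟩ k≈
            (≈-sym ⟨ Tι u , v ⟩ ⟨ u , Tι v ⟩ (Tι-adjoint u v)))
    , Tι-involutive u

  TιF⊆ : ∀ {u} → u ∈ Tι[ F ] → u ∈ 𝒦 n × k ≈ ⟨ u , Tι v ⟩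
  TιF⊆ {u} (m , m∈F , Tιm≋u) =
    -- `Tι u` equals the witness `m` up to `_≋_`, so it lies in `F` and satisfies the equation of
    -- that face.
    let Tιu∈𝒦 , k≈ = F⊆ (face-resp F face (≋-sym (Tι u) m (Tι-swap m u Tιm≋u)) m∈F) in
    Tι-𝒦⁻ u Tιu∈𝒦 , ≈-trans k ⟨ Tι u , v ⟩ ⟨ u , Tι v ⟩ k≈ (Tι-adjoint u v)

-- A competing face `G` through `u` reflects to a face through `m`, which contains `F` by
-- minimality; reflecting back gives the claim.
Tι[]-smallestFace : (m u : ℝ^𝒫 n) (F : Pred (ℝ^𝒫 n) 0ℓ) → Tι m ≋ u →
  IsSmallestFaceContaining m F → IsSmallestFaceContaining u Tι[ F ]
Tι[]-smallestFace m u F Tιm≋u (face , m∈F , smallest) =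
  Tι[]-face F face , (m , m∈F , Tιm≋u) , λ G G-face u∈G →
    ⊆Tι[]⇒Tι[]⊆ F G (face-resp G G-face)
      (smallest Tι[ G ] (Tι[]-face G G-face) (u , u∈G , Tι-swap m u Tιm≋u))

Tι[]-atom : (F : Pred (ℝ^𝒫 n) 0ℓ) → IsAtom F → IsAtom Tι[ F ]
Tι[]-atom {n} F (face , (m , m∈F) , (M⊆F , F⊈M) , covers) =
    Tι[]-face F face
  , (Tι m , ∈⇒Tι∈Tι[] F m m∈F)
  , ((λ {u} → M⊆Tι F M⊆F {u}) , λ TιF⊆M → F⊈M (λ {u} → ⊆M F (λ {w} → TιF⊆M {w}) {u}))
  -- A face strictly between the modular functions and `Tι[ F ]` would reflect to one strictly
  -- between the modular functions and `F`.
  , λ { G G-face (g , g∈G) ((M⊆G , G⊈M) , (G⊆TιF , TιF⊈G)) →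
        covers Tι[ G ] (Tι[]-face G G-face) (Tι g , ∈⇒Tι∈Tι[] G g g∈G)
          ( ((λ {u} → M⊆Tι G M⊆G {u}) ,
            λ TιG⊆M → G⊈M (λ {u} → ⊆M G (λ {w} → TιG⊆M {w}) {u}))
          , ⊆Tι[]⇒Tι[]⊆ G F (face-resp F face) G⊆TιF
          , λ F⊆TιG → TιF⊈G (⊆Tι[]⇒Tι[]⊆ F G (face-resp G G-face) F⊆TιG)) }
  where
  M⊆Tι : (H : Pred (ℝ^𝒫 n) 0ℓ) → Modular n ⊆ H → Modular n ⊆ Tι[ H ]
  M⊆Tι H M⊆H {m} =
    Tι[]⊆⇒⊆Tι[] (Modular n) H (λ {u} u∈ → M⊆H (Tι[Modular]⊆Modular {x = u} u∈)) {m}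

  ⊆M : (H : Pred (ℝ^𝒫 n) 0ℓ) → Tι[ H ] ⊆ Modular n → H ⊆ Modular n
  ⊆M H TιH⊆M {h} h∈H = Tι[Modular]⊆Modular {x = h}
    (Tι[]⊆⇒⊆Tι[] H (Modular n) (λ {u} → TιH⊆M {u}) h∈H)

-- Allowing any `u` with `Tι m ≋ u` lets one implication serve both directions of the equivalence:
-- the converse takes `Tι m` and `m` in place of `m` and `u`.
Tι-extreme : (m u : ℝ^𝒫 n) → Tι m ≋ u → m ∈ Extreme → u ∈ Extreme
Tι-extreme m u Tιm≋u (m∈𝒦 , F , smallest , atom) =
    𝒦-resp (Tι m) u Tιm≋u (Tι-𝒦 m m∈𝒦)
  , Tι[ F ] , Tι[]-smallestFace m u F Tιm≋u smallest , Tι[]-atom F atom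

mainTheorem2 : ∀ {ℓ ℓ₁ ℓ₂ : Level} (n : ℕ) → 2 ℕ.≤ n → (m : ℝ^𝒫 n) →
    ( (m ∈ 𝒦 n ⇔ Tι m ∈ 𝒦 n)
    × (∀ (t : Triplet n) → let open Triplet t in
    t ∈ independencyModel (Tι m) ⇔ a ⊥ b ∣ ∁ (⁅ a ⁆ ∪ ⁅ b ⁆ ∪ C) [ m ])
    × Tι[ 𝒦 n ] ≐ 𝒦 n )
    ×
    ( (∀ (F : Pred (ℝ^𝒫 n) ℓ) → IsFace (𝒦 n) F → IsFace (𝒦 n) Tι[ F ])
    × (∀ (G : Pred (ℝ^𝒫 n) ℓ₁) (F : Pred (ℝ^𝒫 n) ℓ₂) →
    G Respects _≋_ → F Respects _≋_ → G ⊆ F ⇔ Tι[ G ] ⊆ Tι[ F ])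
    × (m ∈ 𝒦 n → m ∈ Extreme ⇔ Tι m ∈ Extreme) )
mainTheorem2 n _ m =
    ( mk⇔ (Tι-𝒦 m) (Tι-𝒦⁻ m)
    , Tι-independency m
    , Tι[𝒦]≐𝒦 )
  , ( Tι[]-face
    , (λ G F _ F-resp → Tι[]-⊆ G F F-resp)
    , λ _ → mk⇔ (Tι-extreme m (Tι m) (≋-refl (Tι m)))
                (Tι-extreme (Tι m) m (Tι-involutive m)) )
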